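{- Let $a$ and $b$ be positive integers with $b\geq\max\{a,3\}$, and let $G$ be a graph of order $n$ with $n\geq\max\{a+2,7\}$. If the minimum degree satisfies $\delta(G)\geq a+1$ and the number of edges satisfies $$e(G)\geq\binom{n-1}{2}+\frac{a+2}{2},$$ then $G$ is a fractional $[a,b]$-deleted graph.
   Context: All graphs are finite, undirected, without loops or multiple edges. For a graph $G$ and vertex $v$, $E_G(v)$ denotes the set of edges incident with $v$. For positive integers $a\leq b$, a fractional $[a,b]$-factor of $G$ is given by a function $h:E(G)\to[0,1]$ such that $a\leq\sum_{e\in E_G(v)}h(e)\leq b$ for every $v\in V(G)$ (the factor being the spanning subgraph with edge set $\{e: h(e)>0\}$). $G$ is called a fractional $[a,b]$-deleted graph if for every edge $e\in E(G)$, the graph $G-e$ has a fractional $[a,b]$-factor. $e(G)$ denotes the number of edges of $G$ and $\delta(G)$ its minimum degree. -}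

module Defs where

open import Data.Nat using (ℕ; zero; suc; _+_; _*_; _∸_; _≤_; _<_)
open import Data.Bool using (Bool; true; false; if_then_else_; _∧_; not)
open import Data.Fin using (Fin; toℕ)
open import Data.Fin.Properties using (_≟_)
open import Data.Nat.ListAction using (sum)
open import Data.List using (List; map; length; filter)
open import Data.List using (allFin)
open import Data.Product using (_×_; Σ; _,_)
open import Relation.Nullary.Decidable using (⌊_⌋)
open import Relation.Binary.PropositionalEquality using (_≡_)
open import Data.Rational using (ℚ; 0ℚ; 1ℚ) renaming (_≤_ to _≤ℚ_; _+_ to _+ℚ_)
import Data.Rational as Q
import Data.Integer
import Data.Bool.Properties

record Graph (n : ℕ) : Set where
  field
    adj   : Fin n → Fin n → Bool
    sym   : ∀ i j → adj i j ≡ adj j i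
    irrefl : ∀ i → adj i i ≡ false

open Graph public

deg : ∀ {n} → Graph n → Fin n → ℕ
deg G i = length (filter (λ j → adj G i j Data.Bool.≟ true) (allFin _))

minDeg≥ : ∀ {n} → Graph n → ℕ → Set
minDeg≥ G k = ∀ i → k ≤ deg G i

numEdges : ∀ {n} → Graph n → ℕ
numEdges {n} G = sum (map (λ i → length (filter (λ j → Data.Nat._<?_ (toℕ i) (toℕ j) Relation.Nullary.Decidable.×-dec (adj G i j Data.Bool.≟ true)) (allFin n))) (allFin n))

sameEdge : ∀ {n} → Fin n → Fin n → Fin n → Fin n → Bool
sameEdge u v i j = (⌊ i ≟ u ⌋ ∧ ⌊ j ≟ v ⌋) Data.Bool.∨ (⌊ i ≟ v ⌋ ∧ ⌊ j ≟ u ⌋)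

deleteEdge : ∀ {n} → (G : Graph n) → Fin n → Fin n → Graph n
deleteEdge G u v = record
  { adj = λ i j → adj G i j ∧ not (sameEdge u v i j)
  ; sym = symP
  ; irrefl = λ i → Relation.Binary.PropositionalEquality.cong (λ b → b ∧ _) (irrefl G i)
  }
  where
  open Relation.Binary.PropositionalEquality
  open Data.Bool.Properties using (∨-comm; ∧-comm)
  swap : ∀ i j → sameEdge u v i j ≡ sameEdge u v j i
  swap i j = trans (∨-comm (⌊ i ≟ u ⌋ ∧ ⌊ j ≟ v ⌋) _)
                   (cong₂ Data.Bool._∨_ (∧-comm ⌊ i ≟ v ⌋ _) (∧-comm ⌊ i ≟ u ⌋ _))
  symP : ∀ i j → (adj G i j ∧ not (sameEdge u v i j)) ≡ (adj G j i ∧ not (sameEdge u v j i))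
  symP i j rewrite Graph.sym G i j | swap i j = refl

sumℚ : List ℚ → ℚ
sumℚ = Data.List.foldr _+ℚ_ 0ℚ

-- A fractional [a,b]-factor of G: an edge weighting h : E(G) → [0,1],
-- represented as a symmetric function on vertex pairs that vanishes on
-- non-edges, with a ≤ Σ_{e ∋ v} h(e) ≤ b at every vertex v.
record FractionalFactor {n : ℕ} (G : Graph n) (a b : ℕ) : Set where
  field
    h        : Fin n → Fin n → ℚ
    h-sym    : ∀ i j → h i j ≡ h j i
    h-nonedge : ∀ i j → adj G i j ≡ false → h i j ≡ 0ℚ
    h-≥0     : ∀ i j → 0ℚ ≤ℚ h i j
    h-≤1     : ∀ i j → h i j ≤ℚ 1ℚ
    lower    : ∀ i → Q._/_ (Data.Integer.+_ a) 1 ≤ℚ sumℚ (map (h i) (allFin n))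
    upper    : ∀ i → sumℚ (map (h i) (allFin n)) ≤ℚ Q._/_ (Data.Integer.+_ b) 1

FractionalDeleted : ∀ {n} → Graph n → ℕ → ℕ → Set
FractionalDeleted G a b = ∀ u v → adj G u v ≡ true → FractionalFactor (deleteEdge G u v) a b

{-# OPTIONS --safe #-}

-- Let H = G - uv and regard its adjacency relation as an n × n matrix of zeros and ones.  It suffices to
-- find a 0/1 matrix M ≤ H with all row and column sums equal to a, since h = (M + Mᵀ) / 2 is then a
-- fractional [a,a]-factor.  By Hoffman's theorem M exists as soon as a|X| + a|Z| ≤ an + e(X,Z) for all sets X
-- of rows and Z of columns; this is seen by fixing the entries one at a time: submodularity of the
-- cut function shows that an undecided entry can be set to 0 or to 1.  Writing N for the number of zeros in
-- X × Z, the condition is N ≤ (|X| - a)(|Z| - a) + a(n - a).  If |X| ≤ a or |Z| ≤ a this is the minimum degree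
-- condition on H; otherwise it follows from the scarcity of zeros, of which H has at most 3n - 2 - a.

module Submission where

open import Defs hiding (sym)
open import Data.Nat using (ℕ; zero; suc; _+_; _*_; _∸_; _≤_; _<_; _⊔_; z≤n; s≤s; s≤s⁻¹; _≤?_; _<?_)
open import Data.Nat.Properties
open import Data.Nat.Tactic.RingSolver using (solve-∀)
import Data.Nat.ListAction as ListAction
open import Data.Bool using (Bool; true; false; _∧_; _∨_; not)
import Data.Bool as Bool
import Data.Bool.Properties as Bool
open import Data.Fin using (Fin; zero; suc; toℕ; punchIn)
import Data.Fin.Properties as Fin
open import Data.Fin.Subset.Properties using (anySubset?)
open import Data.Vec using (lookup; tabulate)
open import Data.Vec.Properties using (lookup∘tabulate)
open import Data.List using (List; []; _∷_; allFin; cartesianProduct; map; length; filter)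
import Data.List as List
open import Data.List.Properties using (map-tabulate)
open import Data.List.Membership.Propositional using (_∈_)
open import Data.List.Membership.Propositional.Properties using (∈-allFin; ∈-cartesianProduct⁺)
open import Data.List.Relation.Unary.Any using (here; there)
open import Data.Product using (∃; ∃₂; _×_; _,_; proj₁; proj₂)
open import Data.Sum using (_⊎_; inj₁; inj₂)
import Data.Integer as ℤ
import Data.Integer.Properties as ℤ
import Data.Integer.Tactic.RingSolver as ℤ
open import Data.Rational using (ℚ; 0ℚ; 1ℚ)
import Data.Rational as ℚ
import Data.Rational.Properties as ℚ
open import Data.Rational.Unnormalised using (mkℚᵘ; *≡*; *≤*)
import Data.Rational.Unnormalised as ℚᵘ
import Data.Rational.Unnormalised.Properties as ℚᵘ
open import Function using (_∘_)
open import Relation.Nullary using (¬_; Dec; yes; no; does; contradiction)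
open import Relation.Nullary.Decidable using (⌊_⌋; map′; _×-dec_; _→-dec_; ¬?; decidable-stable; from-yes)
open import Relation.Binary.PropositionalEquality using (_≡_; _≢_; _≗_; refl; sym; trans; cong; cong₂; subst; subst₂; module ≡-Reasoning)
open import Algebra.Properties.Semiring.Sum +-*-semiring using (sum; sum-cong-≗; sum-replicate-zero; sum-remove; ∑-distrib-+; ∑-comm; *-distribˡ-sum; *-distribʳ-sum)

-- Linear arithmetic, finite sums and 0/1 indicators

-- Certificate form of linear arithmetic: `p ≤ q` is a sum of known inequalities, and `k` gathers
-- the terms that cancel. What remains are two identities, usually left to the ring solver.
linarith : ∀ {l r p q} k → p ≤ q → l + k ≡ p → q ≡ r + k → l ≤ r
linarith k p≤q lk≡p q≡rk = +-cancelʳ-≤ k _ _ (subst₂ _≤_ (sym lk≡p) q≡rk p≤q)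

[_] : Bool → ℕ
[ true  ] = 1
[ false ] = 0

-- Makes entrywise inequalities between indicators decidable, so that `from-yes` can prove them by
-- evaluating the whole truth table.
∀Bool? : {P : Bool → Set} → (∀ b → Dec (P b)) → Dec (∀ b → P b)
∀Bool? P? = map′ (λ { (f , t) false → f ; (f , t) true → t }) (λ p → p false , p true)
                 (P? false ×-dec P? true)

sum-mono-≤ : ∀ {n} {f g : Fin n → ℕ} → (∀ i → f i ≤ g i) → sum f ≤ sum g
sum-mono-≤ {zero}  f≤g = z≤n
sum-mono-≤ {suc n} f≤g = +-mono-≤ (f≤g zero) (sum-mono-≤ (f≤g ∘ suc))

sum-single : ∀ {n} {f : Fin n → ℕ} i → (∀ k → k ≢ i → f k ≡ 0) → sum f ≡ f i
sum-single {suc n} {f} i f≡0 = begin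
  sum f                       ≡⟨ sum-remove f ⟩
  f i + sum (f ∘ punchIn i)   ≡⟨ cong (f i +_) (sum-cong-≗ λ k → f≡0 _ (Fin.punchInᵢ≢i i k)) ⟩
  f i + sum {n} (λ _ → 0)     ≡⟨ cong (f i +_) (sum-replicate-zero n) ⟩
  f i + 0                     ≡⟨ +-identityʳ (f i) ⟩
  f i                         ∎
  where open ≡-Reasoning

sum-const : ∀ n c → sum {n} (λ _ → c) ≡ n * c
sum-const zero    c = refl
sum-const (suc n) c = cong (c +_) (sum-const n c)

δ : ∀ {n} → Fin n → Fin n → Bool
δ i k = ⌊ k Fin.≟ i ⌋

δ-refl : ∀ {n} (i : Fin n) → δ i i ≡ true
δ-refl i with i Fin.≟ i
... | yes _  = refl
... | no i≢i = contradiction refl i≢i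

δ-≢ : ∀ {n} {i k : Fin n} → k ≢ i → δ i k ≡ false
δ-≢ {i = i} {k} k≢i with k Fin.≟ i
... | yes k≡i = contradiction k≡i k≢i
... | no _    = refl

sum-δ : ∀ {n} (i : Fin n) → sum (λ k → [ δ i k ]) ≡ 1
sum-δ i = trans (sum-single i λ k k≢i → cong [_] (δ-≢ k≢i)) (cong [_] (δ-refl i))

Row : ℕ → Set
Row n = Fin n → Bool

Matrix : ℕ → Set
Matrix n = Fin n → Fin n → Bool

∑∑ : ∀ {n} → (Fin n → Fin n → ℕ) → ℕ
∑∑ f = sum λ k → sum (f k)

∑∑-mono-≤ : ∀ {n} {f g : Fin n → Fin n → ℕ} → (∀ k l → f k l ≤ g k l) → ∑∑ f ≤ ∑∑ g
∑∑-mono-≤ f≤g = sum-mono-≤ λ k → sum-mono-≤ (f≤g k)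

∑∑-cong : ∀ {n} {f g : Fin n → Fin n → ℕ} → (∀ k l → f k l ≡ g k l) → ∑∑ f ≡ ∑∑ g
∑∑-cong f≡g = sum-cong-≗ λ k → sum-cong-≗ (f≡g k)

∑∑-distrib-+ : ∀ {n} (f g : Fin n → Fin n → ℕ) → ∑∑ (λ k l → f k l + g k l) ≡ ∑∑ f + ∑∑ g
∑∑-distrib-+ f g =
  trans (sum-cong-≗ λ k → ∑-distrib-+ (f k) (g k)) (∑-distrib-+ (sum ∘ f) (sum ∘ g))

∑∑-* : ∀ {n} (f g : Fin n → ℕ) → ∑∑ (λ k l → f k * g l) ≡ sum f * sum g
∑∑-* f g = trans (sum-cong-≗ λ k → sym (*-distribˡ-sum (f k) g)) (sym (*-distribʳ-sum (sum g) f))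

[∧]-* : ∀ b c → [ b ∧ c ] ≡ [ b ] * [ c ]
[∧]-* false c = refl
[∧]-* true  c = sym (+-identityʳ [ c ])

size : ∀ {n} → Row n → ℕ
size X = sum λ k → [ X k ]

cell : ∀ {n} → Row n → Row n → Matrix n → Fin n → Fin n → ℕ
cell X Z M k l = [ X k ∧ (Z l ∧ M k l) ]

ones : ∀ {n} → Row n → Row n → Matrix n → ℕ
ones X Z M = ∑∑ (cell X Z M)

∁ : ∀ {n} → Row n → Row n
∁ X = not ∘ X

∑∑-δδ : ∀ {n} (i j : Fin n) → ∑∑ (λ k l → [ δ i k ∧ δ j l ]) ≡ 1
∑∑-δδ i j = begin
  ∑∑ (λ k l → [ δ i k ∧ δ j l ])         ≡⟨ ∑∑-cong (λ k l → [∧]-* (δ i k) (δ j l)) ⟩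
  ∑∑ (λ k l → [ δ i k ] * [ δ j l ])     ≡⟨ ∑∑-* (λ k → [ δ i k ]) (λ l → [ δ j l ]) ⟩
  size (δ i) * size (δ j)                    ≡⟨ cong₂ _*_ (sum-δ i) (sum-δ j) ⟩
  1                                      ∎
  where open ≡-Reasoning

-- Matrices with prescribed line sums

-- Hoffman's cut condition for a 0/1 matrix between L and U all of whose row and column sums are a.
CutAt : ∀ {n} → ℕ → Matrix n → Matrix n → Row n → Row n → Set
CutAt {n} a L U X Z = a * size X + a * size Z + ones (∁ X) (∁ Z) L ≤ a * n + ones X Z U

Cut : ∀ {n} → ℕ → Matrix n → Matrix n → Set
Cut a L U = ∀ X Z → CutAt a L U X Z

-- The search in `cut?` runs over vectors, and `lookup (tabulate X)` agrees with `X` only pointwise;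
-- this carries the inequality across.
cutAt-resp : ∀ {n} a (L U : Matrix n) {X X′ Z Z′} → X ≗ X′ → Z ≗ Z′ → CutAt a L U X Z → CutAt a L U X′ Z′
cutAt-resp {n} a L U {X} {X′} {Z} {Z′} X≗X′ Z≗Z′ = subst₂ _≤_
  (cong₂ _+_ (cong₂ (λ x z → a * x + a * z) (size-cong X≗X′) (size-cong Z≗Z′))
             (ones-cong (λ k → cong not (X≗X′ k)) (λ l → cong not (Z≗Z′ l))))
  (cong (a * n +_) (ones-cong X≗X′ Z≗Z′))
  where
  size-cong : ∀ {Y Y′ : Row n} → Y ≗ Y′ → size Y ≡ size Y′
  size-cong Y≗Y′ = sum-cong-≗ λ k → cong [_] (Y≗Y′ k)
  ones-cong : ∀ {Y Y′ W W′} {M : Matrix n} → Y ≗ Y′ → W ≗ W′ → ones Y W M ≡ ones Y′ W′ M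
  ones-cong {M = M} Y≗Y′ W≗W′ =
    ∑∑-cong λ k l → cong₂ (λ y w → [ y ∧ (w ∧ M k l) ]) (Y≗Y′ k) (W≗W′ l)

-- There are finitely many pairs of subsets, so exhaustive search either confirms the condition or
-- produces a violating pair. That pair is the witness that `force-entry` uncrosses.
cut? : ∀ {n} a (L U : Matrix n) → Cut a L U ⊎ ∃₂ λ X Z → ¬ CutAt a L U X Z
cut? {n} a L U with anySubset? {n = n} (λ V → anySubset? {n = n} (λ W → ¬? (cutAt? (lookup V) (lookup W))))
  where
  cutAt? : ∀ X Z → Dec (CutAt a L U X Z)
  cutAt? X Z = _ ≤? _
... | yes (V , W , fails) = inj₂ (lookup V , lookup W , fails)
... | no noFailure = inj₁ λ X Z →
  cutAt-resp a L U (lookup∘tabulate X) (lookup∘tabulate Z)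
    (decidable-stable (_ ≤? _) λ fails → noFailure (tabulate X , tabulate Z , fails))

-- The contribution of one entry to the uncrossing inequality. Here `u ∧ not e` is the upper bound
-- once the chosen entry is forbidden, `l ∨ e` the lower bound once it is forced, and `[ e ]` the
-- price of the change.
UncrossEntry : (x x′ z z′ l u e : Bool) → Set
UncrossEntry x x′ z z′ l u e =
  [ (x ∨ x′) ∧ ((z ∧ z′) ∧ u) ] + [ (x ∧ x′) ∧ ((z ∨ z′) ∧ u) ] +
  ([ not x′ ∧ (not z′ ∧ (l ∨ e)) ] + [ not x ∧ (not z ∧ l) ])
  ≤ [ x ∧ (z ∧ (u ∧ not e)) ] + [ e ] + [ x′ ∧ (z′ ∧ u) ] +
    ([ not (x ∨ x′) ∧ (not (z ∧ z′) ∧ l) ] + [ not (x ∧ x′) ∧ (not (z ∨ z′) ∧ l) ])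

-- For `e = false`: uncrossing changes the count only if one of `(x , z)`, `(x′ , z′)` is
-- `(true , true)` and the other `(false , false)`. Then the `u` terms drop by `u` and the `l` terms
-- by `l`, so `l ≤ u` suffices. For `e = true` the hypotheses make `u` true and `l` false; `[ e ]`
-- pays for forbidding or forcing the entry, and if both occur the drop in the `u` terms pays for
-- the second.
uncross-entry : ∀ x x′ z z′ l u e → l Bool.≤ u → e Bool.≤ u → l Bool.≤ not e → UncrossEntry x x′ z z′ l u e
uncross-entry = from-yes
  (∀Bool? λ x → ∀Bool? λ x′ → ∀Bool? λ z → ∀Bool? λ z′ → ∀Bool? λ l → ∀Bool? λ u → ∀Bool? λ e →
   (l Bool.≤? u) →-dec ((e Bool.≤? u) →-dec ((l Bool.≤? not e) →-dec entry? x x′ z z′ l u e)))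
  where
  entry? : ∀ x x′ z z′ l u e → Dec (UncrossEntry x x′ z z′ l u e)
  entry? _ _ _ _ _ _ _ = _ ≤? _

∨∧-count : ∀ x y → [ x ] + [ y ] ≡ [ x ∨ y ] + [ x ∧ y ]
∨∧-count false y = sym (+-identityʳ [ y ])
∨∧-count true  y = refl

size-∪∩ : ∀ {n} (X Y : Row n) → size X + size Y ≡ size (λ k → X k ∨ Y k) + size (λ k → X k ∧ Y k)
size-∪∩ X Y = begin
  size X + size Y                                         ≡⟨ ∑-distrib-+ (λ k → [ X k ]) (λ k → [ Y k ]) ⟨
  sum (λ k → [ X k ] + [ Y k ])                           ≡⟨ sum-cong-≗ (λ k → ∨∧-count (X k) (Y k)) ⟩
  sum (λ k → [ X k ∨ Y k ] + [ X k ∧ Y k ])               ≡⟨ ∑-distrib-+ (λ k → [ X k ∨ Y k ]) (λ k → [ X k ∧ Y k ]) ⟩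
  size (λ k → X k ∨ Y k) + size (λ k → X k ∧ Y k)           ∎
  where open ≡-Reasoning

-- E is the indicator of a single undecided entry.  If (X , Z) shows that it cannot be 0, uncross (X , Z) and
-- an arbitrary (X′ , Z′) into (X ∪ X′ , Z ∩ Z′) and (X ∩ X′ , Z ∪ Z′).
force-entry : ∀ {n} a (L U E : Matrix n) → (∀ k l → L k l Bool.≤ U k l) →
  (∀ k l → E k l Bool.≤ U k l) → (∀ k l → L k l Bool.≤ not (E k l)) → ∑∑ (λ k l → [ E k l ]) ≡ 1 →
  Cut a L U → ∀ {X Z} → ¬ CutAt a L (λ k l → U k l ∧ not (E k l)) X Z →
  Cut a (λ k l → L k l ∨ E k l) U
force-entry {n} a L U E L≤U E≤U L≤¬E ∑E≡1 cut {X} {Z} fails X′ Z′ =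
  combine (a * n) (a * size X) (a * size X′) (a * size Z) (a * size Z′) (a * size A) (a * size B) (a * size C) (a * size D)
    (ones A B U) (ones C D U) (ones (∁ X′) (∁ Z′) L⁺) (ones (∁ X) (∁ Z) L)
    (ones X Z U⁻) (ones X′ Z′ U) (ones (∁ A) (∁ B) L) (ones (∁ C) (∁ D) L)
    -- A violated inequality of naturals is violated by at least 1, which is exactly the total of
    -- `E`.
    (cut A B) (cut C D) (≰⇒> fails) entries
    (≤-reflexive (scale (size X) (size X′) (size A) (size C) (size-∪∩ X X′)))
    (≤-reflexive (scale (size Z) (size Z′) (size D) (size B) (size-∪∩ Z Z′)))
  where
  U⁻ L⁺ : Matrix n
  U⁻ k l = U k l ∧ not (E k l)
  L⁺ k l = L k l ∨ E k l
  A B C D : Row n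
  A k = X k ∨ X′ k
  B k = Z k ∧ Z′ k
  C k = X k ∧ X′ k
  D k = Z k ∨ Z′ k

  scale : ∀ x x′ s t → x + x′ ≡ s + t → a * x + a * x′ ≡ a * s + a * t
  scale x x′ s t eq = trans (sym (*-distribˡ-+ a x x′)) (trans (cong (a *_) eq) (*-distribˡ-+ a s t))

  entries : ones A B U + ones C D U + (ones (∁ X′) (∁ Z′) L⁺ + ones (∁ X) (∁ Z) L)
          ≤ ones X Z U⁻ + 1 + ones X′ Z′ U + (ones (∁ A) (∁ B) L + ones (∁ C) (∁ D) L)
  entries = subst₂ _≤_
    (trans (∑∑-distrib-+ (λ k l → cell A B U k l + cell C D U k l) (λ k l → cell (∁ X′) (∁ Z′) L⁺ k l + cell (∁ X) (∁ Z) L k l))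
           (cong₂ _+_ (∑∑-distrib-+ (cell A B U) (cell C D U)) (∑∑-distrib-+ (cell (∁ X′) (∁ Z′) L⁺) (cell (∁ X) (∁ Z) L))))
    (trans (∑∑-distrib-+ (λ k l → cell X Z U⁻ k l + [ E k l ] + cell X′ Z′ U k l) (λ k l → cell (∁ A) (∁ B) L k l + cell (∁ C) (∁ D) L k l))
           (cong₂ _+_
             (trans (∑∑-distrib-+ (λ k l → cell X Z U⁻ k l + [ E k l ]) (cell X′ Z′ U))
                    (cong (_+ ones X′ Z′ U)
                          (trans (∑∑-distrib-+ (cell X Z U⁻) (λ k l → [ E k l ])) (cong (ones X Z U⁻ +_) ∑E≡1))))
             (∑∑-distrib-+ (cell (∁ A) (∁ B) L) (cell (∁ C) (∁ D) L))))
    (∑∑-mono-≤ λ k l → uncross-entry (X k) (X′ k) (Z l) (Z′ l) (L k l) (U k l) (E k l)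
                         (L≤U k l) (E≤U k l) (L≤¬E k l))

  combine : ∀ an x x′ z z′ A B C D uAB uCD l⁺ lXZ u⁻ u′ lAB lCD →
    A + B + lAB ≤ an + uAB → C + D + lCD ≤ an + uCD → an + u⁻ < x + z + lXZ →
    uAB + uCD + (l⁺ + lXZ) ≤ u⁻ + 1 + u′ + (lAB + lCD) →
    x + x′ ≤ A + C → z + z′ ≤ D + B →
    x′ + z′ + l⁺ ≤ an + u′
  combine an x x′ z z′ A B C D uAB uCD l⁺ lXZ u⁻ u′ lAB lCD h₁ h₂ h₃ h₄ h₅ h₆ =
    linarith (A + B + C + D + lAB + lCD + an + u⁻ + 1 + uAB + uCD + lXZ + x + z)
      (+-mono-≤ (+-mono-≤ (+-mono-≤ h₁ h₂) (+-mono-≤ h₃ h₄)) (+-mono-≤ h₅ h₆))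
      (eq₁ an x x′ z z′ A B C D uAB uCD l⁺ lXZ u⁻ lAB lCD)
      (eq₂ an x z A B C D uAB uCD lXZ u⁻ u′ lAB lCD)
    where
    eq₁ : ∀ an x x′ z z′ A B C D uAB uCD l⁺ lXZ u⁻ lAB lCD →
      x′ + z′ + l⁺ + (A + B + C + D + lAB + lCD + an + u⁻ + 1 + uAB + uCD + lXZ + x + z) ≡
      A + B + lAB + (C + D + lCD) + (suc (an + u⁻) + (uAB + uCD + (l⁺ + lXZ))) + (x + x′ + (z + z′))
    eq₁ = solve-∀
    eq₂ : ∀ an x z A B C D uAB uCD lXZ u⁻ u′ lAB lCD →
      an + uAB + (an + uCD) + (x + z + lXZ + (u⁻ + 1 + u′ + (lAB + lCD))) + (A + C + (D + B)) ≡
      an + u′ + (A + B + C + D + lAB + lCD + an + u⁻ + 1 + uAB + uCD + lXZ + x + z)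
    eq₂ = solve-∀

δδ-elim : ∀ {n} {i j : Fin n} (P : Fin n → Fin n → Bool → Set) → P i j true → (∀ k l → P k l false) →
  ∀ k l → P k l (δ i k ∧ δ j l)
δδ-elim {i = i} {j} P Pt Pf k l with k Fin.≟ i | l Fin.≟ j
... | yes refl | yes refl = Pt
... | yes _    | no _     = Pf k l
... | no _     | _        = Pf k l

≢⇒free : ∀ {l u} → l Bool.≤ u → l ≢ u → l ≡ false × u ≡ true
≢⇒free Bool.b≤b l≢u = contradiction refl l≢u
≢⇒free Bool.f≤t l≢u = refl , refl

forbid-≤ : ∀ {l u e} → l Bool.≤ u → l Bool.≤ not e → l Bool.≤ u ∧ not e
forbid-≤ {false} _ _ = Bool.≤-minimum _
forbid-≤ {true} {true} _ l≤¬e = l≤¬e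

forbid-shrinks : ∀ u e → u ∧ not e Bool.≤ u
forbid-shrinks false e = Bool.b≤b
forbid-shrinks true  e = Bool.≤-maximum _

forbid-keeps-≡ : ∀ {l u e} → l Bool.≤ not e → l ≡ u → l ≡ u ∧ not e
forbid-keeps-≡ {false} _ refl = refl
forbid-keeps-≡ {true} {e = false} _ refl = refl

force-≤ : ∀ {l u e} → l Bool.≤ u → e Bool.≤ u → l ∨ e Bool.≤ u
force-≤ {false} _ e≤u = e≤u
force-≤ {true} l≤u _ = l≤u

force-keeps-≡ : ∀ {l u e} → e Bool.≤ u → l ≡ u → l ∨ e ≡ u
force-keeps-≡ {true} _ refl = refl
force-keeps-≡ {false} {e = false} _ refl = refl

-- Induction on a list `ps` containing every entry where `L` and `U` still differ. The head is set
-- to 0 if the cut condition survives; otherwise the violating pair allows it to be set to 1. The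
-- final bounds agree only pointwise, so both are returned and `Cut` is stated for the pair.
resolve : ∀ {n} a (ps : List (Fin n × Fin n)) (L U : Matrix n) → (∀ k l → L k l Bool.≤ U k l) → Cut a L U →
  (∀ k l → L k l ≡ U k l ⊎ (k , l) ∈ ps) →
  ∃₂ λ (L′ M : Matrix n) → Cut a L′ M × (∀ k l → L′ k l ≡ M k l) × (∀ k l → M k l Bool.≤ U k l)
resolve a [] L U L≤U cut settled = L , U , cut , (λ k l → done (settled k l)) , λ k l → Bool.≤-refl
  where
  done : ∀ {k l} → L k l ≡ U k l ⊎ (k , l) ∈ [] → L k l ≡ U k l
  done (inj₁ eq) = eq
resolve {n} a ((i , j) ∷ ps) L U L≤U cut settled with L i j Bool.≟ U i j
... | yes Lij≡Uij = resolve a ps L U L≤U cut λ k l → weaken (settled k l)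
  where
  weaken : ∀ {k l} → L k l ≡ U k l ⊎ (k , l) ∈ (i , j) ∷ ps → L k l ≡ U k l ⊎ (k , l) ∈ ps
  weaken (inj₁ eq)           = inj₁ eq
  weaken (inj₂ (here refl))  = inj₁ Lij≡Uij
  weaken (inj₂ (there p∈ps)) = inj₂ p∈ps
... | no Lij≢Uij with cut? a L (λ k l → U k l ∧ not (δ i k ∧ δ j l))
...   | inj₁ cut⁻ =
  let L′ , M , cut′ , L′≡M , M≤U⁻ = resolve a ps L U⁻ L≤U⁻ cut⁻ λ k l → shrink (settled k l)
  in  L′ , M , cut′ , L′≡M , λ k l → Bool.≤-trans (M≤U⁻ k l) (forbid-shrinks (U k l) (E k l))
  where
  E U⁻ : Matrix n
  E k l = δ i k ∧ δ j l
  U⁻ k l = U k l ∧ not (E k l)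
  Lij≡false = proj₁ (≢⇒free (L≤U i j) Lij≢Uij)
  L≤¬E : ∀ k l → L k l Bool.≤ not (E k l)
  L≤¬E = δδ-elim (λ k l e → L k l Bool.≤ not e) (Bool.≤-reflexive Lij≡false) (λ k l → Bool.≤-maximum _)
  L≤U⁻ : ∀ k l → L k l Bool.≤ U⁻ k l
  L≤U⁻ k l = forbid-≤ (L≤U k l) (L≤¬E k l)
  shrink : ∀ {k l} → L k l ≡ U k l ⊎ (k , l) ∈ (i , j) ∷ ps → L k l ≡ U⁻ k l ⊎ (k , l) ∈ ps
  shrink {k} {l} (inj₁ eq)   = inj₁ (forbid-keeps-≡ (L≤¬E k l) eq)
  shrink (inj₂ (here refl))  = inj₁ (trans Lij≡false (sym (trans
    (cong₂ (λ d e → U i j ∧ not (d ∧ e)) (δ-refl i) (δ-refl j)) (Bool.∧-zeroʳ (U i j)))))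
  shrink (inj₂ (there p∈ps)) = inj₂ p∈ps
...   | inj₂ (X , Z , fails) =
  resolve a ps L⁺ U (λ k l → force-≤ (L≤U k l) (E≤U k l))
    (force-entry a L U E L≤U E≤U L≤¬E (∑∑-δδ i j) cut fails) λ k l → grow (settled k l)
  where
  E L⁺ : Matrix n
  E k l = δ i k ∧ δ j l
  L⁺ k l = L k l ∨ E k l
  Lij≡false = proj₁ (≢⇒free (L≤U i j) Lij≢Uij)
  Uij≡true = proj₂ (≢⇒free (L≤U i j) Lij≢Uij)
  L≤¬E : ∀ k l → L k l Bool.≤ not (E k l)
  L≤¬E = δδ-elim (λ k l e → L k l Bool.≤ not e) (Bool.≤-reflexive Lij≡false) (λ k l → Bool.≤-maximum _)
  E≤U : ∀ k l → E k l Bool.≤ U k l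
  E≤U = δδ-elim (λ k l e → e Bool.≤ U k l) (Bool.≤-reflexive (sym Uij≡true)) (λ k l → Bool.≤-minimum _)
  grow : ∀ {k l} → L k l ≡ U k l ⊎ (k , l) ∈ (i , j) ∷ ps → L⁺ k l ≡ U k l ⊎ (k , l) ∈ ps
  grow {k} {l} (inj₁ eq)   = inj₁ (force-keeps-≡ (E≤U k l) eq)
  grow (inj₂ (here refl))  = inj₁ (trans (cong₂ (λ d e → L i j ∨ (d ∧ e)) (δ-refl i) (δ-refl j))
    (trans (Bool.∨-zeroʳ (L i j)) (sym Uij≡true)))
  grow (inj₂ (there p∈ps)) = inj₂ p∈ps

∅ full : ∀ {n} → Row n
∅ _ = false
full _ = true

size-∁ : ∀ {n} (X : Row n) → size X + size (∁ X) ≡ n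
size-∁ {n} X = begin
  size X + size (∁ X)                  ≡⟨ ∑-distrib-+ (λ k → [ X k ]) (λ k → [ not (X k) ]) ⟨
  sum (λ k → [ X k ] + [ not (X k) ])  ≡⟨ sum-cong-≗ (λ k → count (X k)) ⟩
  sum {n} (λ _ → 1)                    ≡⟨ sum-const n 1 ⟩
  n * 1                                ≡⟨ *-identityʳ n ⟩
  n                                    ∎
  where
  open ≡-Reasoning
  count : ∀ b → [ b ] + [ not b ] ≡ 1
  count false = refl
  count true  = refl

size-∅ : ∀ n → size {n} ∅ ≡ 0
size-∅ = sum-replicate-zero

size-full : ∀ n → size {n} full ≡ n
size-full n = trans (sum-const n 1) (*-identityʳ n)

ones-∅ : ∀ {n} (X : Row n) M → ones X ∅ M ≡ 0
ones-∅ {n} X M = begin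
  ones X ∅ M                       ≡⟨ ∑∑-cong (λ k l → cong [_] (Bool.∧-zeroʳ (X k))) ⟩
  ∑∑ {n} (λ k l → 0)               ≡⟨ sum-cong-≗ {n} (λ k → sum-replicate-zero n) ⟩
  sum {n} (λ k → 0)                ≡⟨ sum-replicate-zero n ⟩
  0                                ∎
  where open ≡-Reasoning

ones-row : ∀ {n} (i : Fin n) X M → X i ≡ true → (∀ k → k ≢ i → X k ≡ false) → ones X full M ≡ size (M i)
ones-row {n} i X M Xi X≢i = trans
  (sum-single i λ k k≢i → trans
    (sum-cong-≗ λ l → cong (λ x → [ x ∧ M k l ]) (X≢i k k≢i)) (sum-replicate-zero n))
  (sum-cong-≗ λ l → cong (λ x → [ x ∧ M i l ]) Xi)

-- Take row `i` alone and all columns: the complement has no columns, so the `L` term vanishes.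
rowSum-≥ : ∀ {n} a (L U : Matrix n) → Cut a L U → ∀ i → a ≤ size (U i)
rowSum-≥ {n} a L U cut i = linarith (a * n) (cut (δ i) full)
  (begin
    a + a * n                                                          ≡⟨ cong (_+ a * n) (*-identityʳ a) ⟨
    a * 1 + a * n                                                      ≡⟨ +-identityʳ _ ⟨
    a * 1 + a * n + 0                                                  ≡⟨ cong₂ _+_ (cong₂ (λ x z → a * x + a * z)
                                                                            (sum-δ i) (size-full n)) (ones-∅ (∁ (δ i)) L) ⟨
    a * size (δ i) + a * size (full {n}) + ones (∁ (δ i)) (∁ full) L   ∎)
  (begin
    a * n + ones (δ i) full U   ≡⟨ cong (a * n +_) (ones-row i (δ i) U (δ-refl i) (λ k → δ-≢)) ⟩
    a * n + size (U i)          ≡⟨ +-comm (a * n) _ ⟩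
    size (U i) + a * n          ∎)
  where open ≡-Reasoning

-- Take all rows but `i` and no columns: the `U` term vanishes, and the complement is row `i` in
-- full.
rowSum-≤ : ∀ {n} a (L U : Matrix n) → Cut a L U → ∀ i → size (L i) ≤ a
rowSum-≤ {n} a L U cut i = linarith (a * size X) (cut X ∅)
  (begin
    size (L i) + a * size X                             ≡⟨ +-comm (size (L i)) _ ⟩
    a * size X + size (L i)                             ≡⟨ cong₂ _+_ (sym (trans (cong (λ z → a * size X + a * z) (size-∅ n))
                                                              (trans (cong (a * size X +_) (*-zeroʳ a)) (+-identityʳ _))))
                                                            (sym (ones-row i (∁ X) L (cong (not ∘ not) (δ-refl i))
                                                              (λ k k≢i → cong (not ∘ not) (δ-≢ k≢i)))) ⟩
    a * size X + a * size (∅ {n}) + ones (∁ X) (∁ ∅) L  ∎)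
  (begin
    a * n + ones X ∅ U          ≡⟨ cong (a * n +_) (ones-∅ X U) ⟩
    a * n + 0                   ≡⟨ +-identityʳ _ ⟩
    a * n                       ≡⟨ cong (a *_) (size-∁ (δ i)) ⟨
    a * (size (δ i) + size X)   ≡⟨ cong (λ d → a * (d + size X)) (sum-δ i) ⟩
    a * suc (size X)            ≡⟨ *-suc a (size X) ⟩
    a + a * size X              ∎)
  where
  open ≡-Reasoning
  X = ∁ (δ i)

_ᵀ : ∀ {n} → Matrix n → Matrix n
(M ᵀ) k l = M l k

ones-ᵀ : ∀ {n} (X Z : Row n) M → ones X Z (M ᵀ) ≡ ones Z X M
ones-ᵀ X Z M = trans (∑-comm (cell X Z (M ᵀ))) (∑∑-cong λ l k → cong [_] (swap (X k) (Z l) (M l k)))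
  where
  swap : ∀ x z m → x ∧ (z ∧ m) ≡ z ∧ (x ∧ m)
  swap false false m = refl
  swap false true  m = refl
  swap true  false m = refl
  swap true  true  m = refl

-- The condition treats rows and columns alike, so the bounds on column sums are those on row sums
-- of the transpose.
cut-ᵀ : ∀ {n} a (L U : Matrix n) → Cut a L U → Cut a (L ᵀ) (U ᵀ)
cut-ᵀ {n} a L U cut X Z = subst₂ _≤_
  (cong₂ _+_ (+-comm (a * size Z) _) (sym (ones-ᵀ (∁ X) (∁ Z) L)))
  (cong (a * n +_) (sym (ones-ᵀ X Z U)))
  (cut Z X)

-- `resolve` starts from the zero lower bound, for which the cut condition is `cond`, with every
-- entry undecided. Once the two bounds coincide, the lower and upper estimates of each line sum
-- meet at `a`.
regular-submatrix : ∀ {n} a (U : Matrix n) →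
  (∀ X Z → a * size X + a * size Z ≤ a * n + ones X Z U) →
  ∃ λ (M : Matrix n) → (∀ k l → M k l Bool.≤ U k l) × (∀ k → size (M k) ≡ a) × (∀ l → size ((M ᵀ) l) ≡ a)
regular-submatrix {n} a U cond =
  let L , M , cut , L≡M , M≤U = resolve a (cartesianProduct (allFin n) (allFin n)) (λ _ _ → false) U
        (λ k l → Bool.≤-minimum _)
        (λ X Z → subst (_≤ a * n + ones X Z U) (sym (trans (cong (a * size X + a * size Z +_) (ones-false (∁ X) (∁ Z)))
                                          (+-identityʳ _))) (cond X Z))
        (λ k l → inj₂ (∈-cartesianProduct⁺ (∈-allFin k) (∈-allFin l)))
  in  M , M≤U
    , (λ k → ≤-antisym (subst (_≤ a) (sum-cong-≗ λ l → cong [_] (L≡M k l)) (rowSum-≤ a L M cut k))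
                       (rowSum-≥ a L M cut k))
    , (λ l → ≤-antisym (subst (_≤ a) (sum-cong-≗ λ k → cong [_] (L≡M k l)) (rowSum-≤ a (L ᵀ) (M ᵀ) (cut-ᵀ a L M cut) l))
                       (rowSum-≥ a (L ᵀ) (M ᵀ) (cut-ᵀ a L M cut) l))
  where
  ones-false : ∀ X Z → ones X Z (λ _ _ → false) ≡ 0
  ones-false X Z = trans
    (∑∑-cong λ k l → cong (λ b → [ X k ∧ b ]) (Bool.∧-zeroʳ (Z l)))
    (ones-∅ X (λ _ _ → false))

-- Arithmetic of the cut condition

-- The case `a = 1`, `|X| = 2`, `|Z| = 1 + q`, `n = 7 + d`. For `2 + q ≤ 6 + d` the area suffices.
-- For larger `q` the total count would give only `N ≤ 2 * n - 1`, which is too weak; `square` gives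
-- `2 * N ≤ 22 + 3 * d`, while twice the goal is at least `22 + 4 * d`.
bound-1-1 : ∀ d q C N → N ≤ (1 + 1) * (1 + q) → N + N ≤ C + 4 → C + 3 ≤ 3 * (7 + d) → N ≤ 1 * (6 + d) + 1 * q
bound-1-1 d q C N area square total with 2 + q ≤? 6 + d
... | yes 2+q≤d = linarith (2 + q) (+-mono-≤ area 2+q≤d) refl (eq d q)
  where
  eq : ∀ d q → 2 * (1 + q) + (6 + d) ≡ 1 * (6 + d) + 1 * q + (2 + q)
  eq = solve-∀
... | no 2+q≰d = *-cancelˡ-≤ 2 (linarith (C + 17 + 2 * d)
        (+-mono-≤ (+-mono-≤ square total) (+-mono-≤ (≰⇒> 2+q≰d) (+-mono-≤ (≰⇒> 2+q≰d) (z≤n {d}))))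
        (eq₁ N C d) (eq₂ C d q))
  where
  eq₁ : ∀ N C d → 2 * N + (C + 17 + 2 * d) ≡ N + N + (C + 3) + (7 + d + (7 + d + 0))
  eq₁ = solve-∀
  eq₂ : ∀ C d q → C + 4 + 3 * (7 + d) + (2 + q + (2 + q + d)) ≡ 2 * (1 * (6 + d) + 1 * q) + (C + 17 + 2 * d)
  eq₂ = solve-∀

-- Write `P = 2 + p` and `Q = P + r`. If `P ≥ 3`, then `d + P ≤ 2 * P + Q ≤ P * Q`. If `P = 2`,
-- doubling `d ≤ 2 + Q` and using `6 ≤ d` gives the claim.
product-bound : ∀ d p r → 6 ≤ d → d ≤ (2 + p) + (2 + p + r) → d + (2 + p) ≤ (2 + p) * (2 + p + r)
product-bound d 0 r 6≤d d≤p+q =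
  linarith (4 + d) (+-mono-≤ (+-mono-≤ d≤p+q d≤p+q) 6≤d) (eq₁ d) (eq₂ d r)
  where
  eq₁ : ∀ d → d + 2 + (4 + d) ≡ d + d + 6
  eq₁ = solve-∀
  eq₂ : ∀ d r → 2 + (2 + r) + (2 + (2 + r)) + d ≡ 2 * (2 + r) + (4 + d)
  eq₂ = solve-∀
product-bound d (suc p) r _ d≤p+q =
  linarith 0 (+-mono-≤ (+-monoˡ-≤ (3 + p) d≤p+q) (z≤n {2 * (p + r) + p + p * (p + r)})) refl (eq p r)
  where
  eq : ∀ p r → 3 + p + (3 + p + r) + (3 + p) + (2 * (p + r) + p + p * (p + r)) ≡ (3 + p) * (3 + p + r) + 0
  eq = solve-∀

-- The case `a = 1`, `n = 1 + d`, with `P = 2 + p` the excess of `|X|` over `a`. The area is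
-- `(P + 1) * (q + 1)`, which settles `1 + P + q ≤ d`. Otherwise the total count gives
-- `N ≤ d + (d + P)`, and `product-bound` applies.
bound-1 : ∀ d p r C N → let q = 2 + p + r in 6 ≤ d → N ≤ (3 + p) * (1 + q) →
  N + (1 + d) ≤ C + (3 + p) → C + 3 ≤ 3 * (1 + d) → N ≤ 1 * d + (2 + p) * q
bound-1 d p r C N 6≤d area total C-bound with 1 + ((2 + p) + (2 + p + r)) ≤? d
... | yes small = linarith (1 + ((2 + p) + (2 + p + r))) (+-mono-≤ area small) refl (eq d p r)
  where
  eq : ∀ d p r → (3 + p) * (3 + p + r) + d ≡ 1 * d + (2 + p) * (2 + p + r) + (1 + ((2 + p) + (2 + p + r)))
  eq = solve-∀
... | no large = linarith (6 + 2 * d + C + p)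
        (+-mono-≤ (+-mono-≤ total C-bound) (product-bound d p r 6≤d (s≤s⁻¹ (≰⇒> large))))
        (eq₁ d p C N) (eq₂ d p ((2 + p) * (2 + p + r)) C)
  where
  eq₁ : ∀ d p C N → N + (6 + 2 * d + C + p) ≡ N + (1 + d) + (C + 3) + (d + (2 + p))
  eq₁ = solve-∀
  eq₂ : ∀ d p m C → C + (3 + p) + 3 * (1 + d) + m ≡ 1 * d + m + (6 + 2 * d + C + p)
  eq₂ = solve-∀

-- Isolates the two small shapes for which the total count is too weak when `a = 2`.
small⊎2+p≤p*q : ∀ p r → let q = 1 + p + r in (p ≡ 0 × r ≤ 1) ⊎ 3 + p ≤ (1 + p) * q
small⊎2+p≤p*q 0 0             = inj₁ (refl , z≤n)
small⊎2+p≤p*q 0 1             = inj₁ (refl , s≤s z≤n)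
small⊎2+p≤p*q 0 (suc (suc r)) = inj₂ (m≤m+n 3 (r + 0))
small⊎2+p≤p*q (suc p) r       =
  inj₂ (linarith 0 (m≤m+n (4 + p) (3 * p + p * p + 2 * r + p * r)) (+-identityʳ _) (eq p r))
  where
  eq : ∀ p r → 4 + p + (3 * p + p * p + 2 * r + p * r) ≡ (2 + p) * (2 + p + r) + 0
  eq = solve-∀

-- The case `a = 2`, `n = 7 + d`. The total count gives `N ≤ 2 * (5 + d) + (3 + p)`, enough unless
-- `p = 0` and `r ≤ 1`; there the area is at most 12 and suffices.
bound-2 : ∀ d p r C N → let q = 1 + p + r in N ≤ (3 + p) * (2 + q) →
  N + (7 + d) ≤ C + (3 + p) → C + 4 ≤ 3 * (7 + d) → N ≤ 2 * (5 + d) + (1 + p) * q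
bound-2 d p r C N area total C-bound with small⊎2+p≤p*q p r
... | inj₁ (refl , r≤1) = linarith (2 * r) (+-mono-≤ (+-mono-≤ area (+-mono-≤ r≤1 r≤1)) (z≤n {2 * d})) (eq₁ N r) (eq₂ d r)
  where
  eq₁ : ∀ N r → N + (2 * r) ≡ N + (r + r) + 0
  eq₁ = solve-∀
  eq₂ : ∀ d r → 3 * (3 + r) + 2 + 2 * d ≡ 2 * (5 + d) + 1 * (1 + r) + (2 * r)
  eq₂ = solve-∀
... | inj₂ large = linarith (14 + d + C + p) (+-mono-≤ (+-mono-≤ total C-bound) large)
    (eq₁ d p C N) (eq₂ d p ((1 + p) * (1 + p + r)) C)
  where
  eq₁ : ∀ d p C N → N + (14 + d + C + p) ≡ N + (7 + d) + (C + 4) + (3 + p)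
  eq₁ = solve-∀
  eq₂ : ∀ d p m C → C + (3 + p) + 3 * (7 + d) + m ≡ 2 * (5 + d) + m + (14 + d + C + p)
  eq₂ = solve-∀

-- The total count gives `N ≤ 2 * (a + d) - 1 + p`. Since `a * d - 2 * (a + d) = (1 + s) * (1 + t) -
-- 4 ≥ -2`, the summand `(1 + p) * q ≥ 1 + p` covers the rest.
bound-middle : ∀ s t p r C N → let a = 3 + s ; d = 3 + t ; q = 1 + p + r in 1 ≤ s + t →
  N + (a + d) ≤ C + (a + (1 + p)) → C + (2 + a) ≤ 3 * (a + d) → N ≤ a * d + (1 + p) * q
bound-middle s t p r C N 1≤s+t total C-bound =
  linarith (12 + 2 * s + t + C) (+-mono-≤ (+-mono-≤ (+-mono-≤ total C-bound) 1≤s+t) (z≤n {s * t + p * (1 + p + r) + r}))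
    (eq₁ s t C N) (eq₂ s t p r C)
  where
  eq₁ : ∀ s t C N → N + (12 + 2 * s + t + C) ≡ N + (3 + s + (3 + t)) + (C + (2 + (3 + s))) + 1 + 0
  eq₁ = solve-∀
  eq₂ : ∀ s t p r C → C + (3 + s + (1 + p)) + 3 * (3 + s + (3 + t)) + (s + t) + (s * t + p * (1 + p + r) + r) ≡
    (3 + s) * (3 + t) + (1 + p) * (1 + p + r) + (12 + 2 * s + t + C)
  eq₂ = solve-∀

-- Here `n = a + 2`, so minimum degree `a + 1` makes the original graph complete. The zeros are then
-- the diagonal and the two entries of the deleted edge, `C ≤ n + 2`, whence `N ≤ a + 3 + p`.
bound-complete : ∀ s p r C N → let a = 5 + s ; q = 1 + p + r in
  N + (a + 2) ≤ C + (a + (1 + p)) → C + (a + 2) * (a + 1) ≤ (a + 2) * (a + 2) + 2 → N ≤ a * 2 + (1 + p) * q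
bound-complete s p r C N total C-bound =
  linarith (C + (5 + s + 2) + (5 + s + 2) * (5 + s + 1)) (+-mono-≤ (+-mono-≤ total C-bound) (z≤n {3 + s + p * (1 + p + r) + r}))
    (eq₁ s C N) (eq₂ s p r C)
  where
  eq₁ : ∀ s C N → N + (C + (5 + s + 2) + (5 + s + 2) * (5 + s + 1)) ≡
    N + (5 + s + 2) + (C + (5 + s + 2) * (5 + s + 1)) + 0
  eq₁ = solve-∀
  eq₂ : ∀ s p r C → C + (5 + s + (1 + p)) + ((5 + s + 2) * (5 + s + 2) + 2) + (3 + s + p * (1 + p + r) + r) ≡
    (5 + s) * 2 + (1 + p) * (1 + p + r) + (C + (5 + s + 2) + (5 + s + 2) * (5 + s + 1))
  eq₂ = solve-∀

-- The cut inequality rewritten with x = a + (1 + p), z = a + q, n = a + d.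
count-bound : ∀ a d p r C N → let n = a + d ; x = a + (1 + p) ; q = 1 + p + r in
  1 ≤ a → 2 ≤ d → 7 ≤ n → N ≤ x * (a + q) → N + n ≤ C + x → N + N ≤ C + x * x →
  C + (2 + a) ≤ 3 * n → C + n * (a + 1) ≤ n * n + 2 →
  N ≤ a * d + (1 + p) * q
count-bound 1 d p r C N _ _ (s≤s 6≤d) area total square C-bound _ with m≤n⇒∃[o]m+o≡n 6≤d | p
... | d′ , refl | 0      = bound-1-1 d′ (1 + r) C N area square C-bound
... | d′ , refl | suc p′ = bound-1 (6 + d′) p′ r C N 6≤d area total C-bound
count-bound 2 d p r C N _ _ (s≤s (s≤s 5≤d)) area total _ C-bound _ with m≤n⇒∃[o]m+o≡n 5≤d
... | d′ , refl = bound-2 d′ p r C N area total C-bound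
count-bound (suc (suc (suc s))) 2 p r C N _ _ (s≤s (s≤s (s≤s 4≤s+2))) _ total _ _ C-bound
  with m≤n⇒∃[o]m+o≡n (+-cancelʳ-≤ 2 2 s 4≤s+2)
... | s′ , refl = bound-complete s′ p r C N total C-bound
count-bound (suc (suc (suc s))) (suc (suc (suc t))) p r C N _ _ 7≤n _ total _ C-bound _ =
  bound-middle s t p r C N
    (+-cancelˡ-≤ 6 1 (s + t) (subst (7 ≤_) (eq s t) 7≤n)) total C-bound
  where
  eq : ∀ s t → 3 + s + (3 + t) ≡ 6 + (s + t)
  eq = solve-∀
count-bound (suc (suc (suc s))) 1 p r C N _ (s≤s ()) _ _ _ _ _ _

<-offset : ∀ {a x} → a < x → ∃ λ p → a + suc p ≡ x
<-offset {a} a<x = let p , eq = m≤n⇒∃[o]m+o≡n a<x in p , trans (+-suc a p) eq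

+-offset : ∀ a p {z} → a + p ≤ z → ∃ λ r → a + (p + r) ≡ z
+-offset a p a+p≤z = let r , eq = m≤n⇒∃[o]m+o≡n a+p≤z in r , trans (sym (+-assoc a p r)) eq

cut-bound : ∀ a n x z C N → 1 ≤ a → a + 2 ≤ n → 7 ≤ n → x ≤ z → z ≤ n →
  N ≤ x * z → N + x * a ≤ x * n → N + n ≤ C + x → N + N ≤ C + x * x →
  C + (2 + a) ≤ 3 * n → C + n * (a + 1) ≤ n * n + 2 →
  a * x + a * z + N ≤ a * n + x * z
cut-bound a n x z C N 1≤a a+2≤n 7≤n x≤z z-bound area degree total square C-bound C-bound′ with ≤-<-connex x a
... | inj₁ x≤a with m≤n⇒∃[o]m+o≡n x≤a | m≤n⇒∃[o]m+o≡n z-bound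
-- For `x ≤ a` the degree bound leaves `x * n + a * z ≤ a * n + x * z`, that is
-- `(a - x) * (n - z) ≥ 0`; the product is `s * t`.
...   | s , refl | t , refl = linarith 0 (+-mono-≤ degree (m≤m+n (a * z) (s * t))) (eq₁ x a z N) (eq₂ x s z t)
  where
  eq₁ : ∀ x a z N → a * x + a * z + N + 0 ≡ N + x * a + a * z
  eq₁ = solve-∀
  eq₂ : ∀ x s z t → x * (z + t) + ((x + s) * z + s * t) ≡ (x + s) * (z + t) + x * z + 0
  eq₂ = solve-∀
cut-bound a n x z C N 1≤a a+2≤n 7≤n x≤z z-bound area degree total square C-bound C-bound′ | inj₂ a<x
  with p , refl ← <-offset a<x
  with r , refl ← +-offset a (suc p) x≤z
  with d , refl ← m≤n⇒∃[o]m+o≡n (≤-trans (m≤m+n a 2) a+2≤n) =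
  linarith 0 (+-monoʳ-≤ (a * (a + (1 + p)) + a * (a + (1 + p + r)))
    (count-bound a d p r C N 1≤a (+-cancelˡ-≤ a 2 d a+2≤n) 7≤n area total square C-bound C-bound′))
    (+-identityʳ _) (eq a d p r)
  where
  eq : ∀ a d p r → a * (a + (1 + p)) + a * (a + (1 + p + r)) + (a * d + (1 + p) * (1 + p + r)) ≡
    a * (a + d) + (a + (1 + p)) * (a + (1 + p + r)) + 0
  eq = solve-∀

-- Counting zeros

module _ {n} (U : Matrix n) where

  -- Counts matrix entries: for an adjacency matrix, `non-edges full full` includes the diagonal and
  -- each missing edge twice.
  non-edges : Row n → Row n → ℕ
  non-edges X Z = ones X Z (λ k l → not (U k l))

  edges+non-edges : ∀ X Z → ones X Z U + non-edges X Z ≡ size X * size Z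
  edges+non-edges X Z = begin
    ones X Z U + non-edges X Z
      ≡⟨ ∑∑-distrib-+ (cell X Z U) (cell X Z (λ k l → not (U k l))) ⟨
    ∑∑ (λ k l → cell X Z U k l + cell X Z (λ k l → not (U k l)) k l)
      ≡⟨ ∑∑-cong (λ k l → split (X k) (Z l) (U k l)) ⟩
    ∑∑ (λ k l → [ X k ] * [ Z l ])
      ≡⟨ ∑∑-* (λ k → [ X k ]) (λ l → [ Z l ]) ⟩
    size X * size Z ∎
    where
    open ≡-Reasoning
    split : ∀ x z u → [ x ∧ (z ∧ u) ] + [ x ∧ (z ∧ not u) ] ≡ [ x ] * [ z ]
    split false z     u     = refl
    split true  false u     = refl
    split true  true  false = refl
    split true  true  true  = refl

  non-edges-by-degree : ∀ a → (∀ k → a ≤ size (U k)) → ∀ X Z → non-edges X Z + size X * a ≤ size X * n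
  non-edges-by-degree a degree X Z = subst₂ _≤_
    (trans (∑-distrib-+ (λ k → sum (cell X Z (λ k l → not (U k l)) k)) (λ k → [ X k ] * a))
           (cong (non-edges X Z +_) (sym (*-distribʳ-sum a (λ k → [ X k ])))))
    (sym (*-distribʳ-sum n (λ k → [ X k ])))
    (sum-mono-≤ λ k → row k (X k))
    where
    row : ∀ k x → sum (λ l → [ x ∧ (Z l ∧ not (U k l)) ]) + [ x ] * a ≤ [ x ] * n
    row k false = ≤-reflexive (trans (+-identityʳ _) (sum-replicate-zero n))
    row k true  = begin
      sum (λ l → [ Z l ∧ not (U k l) ]) + (a + 0)  ≡⟨ cong (sum (λ l → [ Z l ∧ not (U k l) ]) +_) (+-identityʳ a) ⟩
      sum (λ l → [ Z l ∧ not (U k l) ]) + a        ≤⟨ +-mono-≤ (sum-mono-≤ λ l → drop (Z l) (not (U k l))) (degree k) ⟩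
      size (∁ (U k)) + size (U k)                  ≡⟨ +-comm (size (∁ (U k))) _ ⟩
      size (U k) + size (∁ (U k))                  ≡⟨ size-∁ (U k) ⟩
      n                                            ≡⟨ +-identityʳ n ⟨
      n + 0                                        ∎
      where
      open ≤-Reasoning
      drop : ∀ z u → [ z ∧ u ] ≤ [ u ]
      drop false u = z≤n
      drop true  u = ≤-refl

  -- Every row outside X still contains a diagonal zero.
  non-edges-by-total : (∀ k → U k k ≡ false) → ∀ X Z → non-edges X Z + n ≤ non-edges full full + size X
  non-edges-by-total irr X Z = subst₂ _≤_
    (trans (∑∑-distrib-+ (cell X Z (λ k l → not (U k l))) (λ k l → [ δ k l ]))
           (cong (non-edges X Z +_) (trans (sum-cong-≗ (sum-δ {n})) (size-full n))))
    (trans (∑∑-distrib-+ (λ k l → [ not (U k l) ]) (λ k l → [ X k ] * [ δ k l ]))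
           (cong (non-edges full full +_) (sum-cong-≗ λ k →
             trans (sym (*-distribˡ-sum [ X k ] (λ l → [ δ k l ]))) (trans (cong ([ X k ] *_) (sum-δ k)) (*-identityʳ _)))))
    (∑∑-mono-≤ entry)
    where
    entry : ∀ k l → [ X k ∧ (Z l ∧ not (U k l)) ] + [ δ k l ] ≤ [ not (U k l) ] + [ X k ] * [ δ k l ]
    entry k l with l Fin.≟ k
    ... | yes refl rewrite irr k = diagonal (X k) (Z k)
      where
      diagonal : ∀ x z → [ x ∧ (z ∧ true) ] + 1 ≤ 1 + [ x ] * 1
      diagonal = from-yes (∀Bool? λ x → ∀Bool? λ z → ([ x ∧ (z ∧ true) ] + 1) ≤? (1 + [ x ] * 1))
    ... | no _ = off-diagonal (X k) (Z l) (not (U k l))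
      where
      off-diagonal : ∀ x z c → [ x ∧ (z ∧ c) ] + 0 ≤ [ c ] + [ x ] * 0
      off-diagonal = from-yes (∀Bool? λ x → ∀Bool? λ z → ∀Bool? λ c →
        ([ x ∧ (z ∧ c) ] + 0) ≤? ([ c ] + [ x ] * 0))

  module _ (symm : ∀ k l → U k l ≡ U l k) where

    non-edges-sym : ∀ X Z → non-edges X Z ≡ non-edges Z X
    non-edges-sym X Z = trans
      (∑∑-cong λ k l → cong (λ u → [ X k ∧ (Z l ∧ not u) ]) (symm k l))
      (ones-ᵀ X Z (λ k l → not (U k l)))

    -- A zero lying in both X × Z and Z × X lies in X × X.
    non-edges-by-square : ∀ X Z → non-edges X Z + non-edges X Z ≤ non-edges full full + size X * size X
    non-edges-by-square X Z = subst₂ _≤_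
      (trans (∑∑-distrib-+ (cell X Z (λ k l → not (U k l))) (cell Z X (λ k l → not (U k l))))
             (cong (non-edges X Z +_) (non-edges-sym Z X)))
      (trans (∑∑-distrib-+ (λ k l → [ not (U k l) ]) (λ k l → [ X k ] * [ X l ]))
             (cong (non-edges full full +_) (∑∑-* (λ k → [ X k ]) (λ k → [ X k ]))))
      (∑∑-mono-≤ λ k l → entry (X k) (X l) (Z k) (Z l) (not (U k l)))
      where
      entry : ∀ x x′ z z′ c → [ x ∧ (z′ ∧ c) ] + [ z ∧ (x′ ∧ c) ] ≤ [ c ] + [ x ] * [ x′ ]
      entry = from-yes (∀Bool? λ x → ∀Bool? λ x′ → ∀Bool? λ z → ∀Bool? λ z′ → ∀Bool? λ c →
        ([ x ∧ (z′ ∧ c) ] + [ z ∧ (x′ ∧ c) ]) ≤? ([ c ] + [ x ] * [ x′ ]))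

    dense⇒cut : ∀ a → 1 ≤ a → a + 2 ≤ n → 7 ≤ n → (∀ k → U k k ≡ false) → (∀ k → a ≤ size (U k)) →
      (n ∸ 1) * (n ∸ 2) + a ≤ ones full full U → n * (a + 1) ≤ ones full full U + 2 →
      ∀ X Z → a * size X + a * size Z ≤ a * n + ones X Z U
    dense⇒cut a 1≤a a+2≤n 7≤n irr degree dense dense′ X Z =
      linarith (non-edges X Z) (bound (≤-total (size X) (size Z))) refl
        (trans (cong (a * n +_) (sym (edges+non-edges X Z))) (sym (+-assoc (a * n) _ _)))
      where
      C = non-edges full full

      S+C≡n*n : ones full full U + C ≡ n * n
      S+C≡n*n = trans (edges+non-edges full full) (cong₂ _*_ (size-full n) (size-full n))

      -- This is `n * n - (n - 1) * (n - 2) = 3 * n - 2`; writing `n = 2 + m` removes the truncated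
      -- subtraction.
      C-bound : C + (2 + a) ≤ 3 * n
      C-bound with m , refl ← m≤n⇒∃[o]m+o≡n (≤-trans (m≤n+m 2 a) a+2≤n) =
        linarith ((1 + m) * m + ones full full U) (+-monoˡ-≤ 2 (+-mono-≤ dense (≤-reflexive S+C≡n*n))) (eq₁ C a m (ones full full U)) (eq₂ m (ones full full U))
        where
        eq₁ : ∀ C a m S → C + (2 + a) + ((1 + m) * m + S) ≡ (1 + m) * m + a + (S + C) + 2
        eq₁ = solve-∀
        eq₂ : ∀ m S → S + (2 + m) * (2 + m) + 2 ≡ 3 * (2 + m) + ((1 + m) * m + S)
        eq₂ = solve-∀

      C-bound′ : C + n * (a + 1) ≤ n * n + 2
      C-bound′ = linarith (ones full full U) (+-mono-≤ dense′ (≤-reflexive S+C≡n*n)) (eq₁ C (n * (a + 1)) (ones full full U)) (eq₂ (n * n) (ones full full U))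
        where
        eq₁ : ∀ C m S → C + m + S ≡ m + (S + C)
        eq₁ = solve-∀
        eq₂ : ∀ m S → S + 2 + m ≡ m + 2 + S
        eq₂ = solve-∀

      size≤n : ∀ Y → size Y ≤ n
      size≤n Y = ≤-trans (m≤m+n (size Y) (size (∁ Y))) (≤-reflexive (size-∁ Y))

      area : ∀ Y W → non-edges Y W ≤ size Y * size W
      area Y W = ≤-trans (m≤n+m _ _) (≤-reflexive (edges+non-edges Y W))

      ordered : ∀ Y W → size Y ≤ size W → a * size Y + a * size W + non-edges Y W ≤ a * n + size Y * size W
      ordered Y W Y≤W = cut-bound a n (size Y) (size W) C (non-edges Y W) 1≤a a+2≤n 7≤n Y≤W (size≤n W)
        (area Y W) (non-edges-by-degree a degree Y W) (non-edges-by-total irr Y W) (non-edges-by-square Y W)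
        C-bound C-bound′

      -- `ordered` wants the smaller set as the rows; symmetry of `U` allows the exchange.
      bound : size X ≤ size Z ⊎ size Z ≤ size X → a * size X + a * size Z + non-edges X Z ≤ a * n + size X * size Z
      bound (inj₁ X≤Z) = ordered X Z X≤Z
      bound (inj₂ Z≤X) = subst₂ _≤_
        (cong₂ _+_ (+-comm (a * size Z) _) (non-edges-sym Z X))
        (cong (a * n +_) (*-comm (size Z) (size X)))
        (ordered Z X Z≤X)

-- Graphs

length-filter-tabulate : ∀ {A : Set} {P : A → Set} (P? : ∀ x → Dec (P x)) {n} (f : Fin n → A) →
  length (filter P? (List.tabulate f)) ≡ size (λ i → does (P? (f i)))
length-filter-tabulate P? {zero}  f = refl
length-filter-tabulate P? {suc n} f with does (P? (f zero))
... | true  = cong suc (length-filter-tabulate P? (f ∘ suc))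
... | false = length-filter-tabulate P? (f ∘ suc)

sum-tabulate : ∀ {n} (f : Fin n → ℕ) → ListAction.sum (List.tabulate f) ≡ sum f
sum-tabulate {zero}  f = refl
sum-tabulate {suc n} f = cong (f zero +_) (sum-tabulate (f ∘ suc))

does-≟-true : ∀ b → does (b Bool.≟ true) ≡ b
does-≟-true false = refl
does-≟-true true  = refl

deg≡size : ∀ {n} (G : Graph n) i → deg G i ≡ size (adj G i)
deg≡size G i = trans (length-filter-tabulate (λ j → adj G i j Bool.≟ true) (λ j → j))
  (sum-cong-≗ λ j → cong [_] (does-≟-true (adj G i j)))

infix 7 _<ᵇ_
_<ᵇ_ : ∀ {n} → Fin n → Fin n → Bool
i <ᵇ j = does (toℕ i <? toℕ j)

numEdges≡ : ∀ {n} (G : Graph n) → numEdges G ≡ ∑∑ (λ i j → [ i <ᵇ j ∧ adj G i j ])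
numEdges≡ {n} G = begin
  numEdges G
    ≡⟨ cong ListAction.sum (map-tabulate (λ i → i) row) ⟩
  ListAction.sum (List.tabulate row)
    ≡⟨ sum-tabulate row ⟩
  sum row
    ≡⟨ sum-cong-≗ (λ i → length-filter-tabulate (λ j → (toℕ i <? toℕ j) ×-dec (adj G i j Bool.≟ true)) (λ j → j)) ⟩
  ∑∑ (λ i j → [ i <ᵇ j ∧ does (adj G i j Bool.≟ true) ])
    ≡⟨ ∑∑-cong (λ i j → cong (λ b → [ i <ᵇ j ∧ b ]) (does-≟-true (adj G i j))) ⟩
  ∑∑ (λ i j → [ i <ᵇ j ∧ adj G i j ]) ∎
  where
  open ≡-Reasoning
  row : Fin n → ℕ
  row i = length (filter (λ j → (toℕ i <? toℕ j) ×-dec (adj G i j Bool.≟ true)) (allFin n))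

exclusive : ∀ {P Q : Set} (P? : Dec P) (Q? : Dec Q) → (P → ¬ Q) → ∀ b → [ does P? ∧ b ] + [ does Q? ∧ b ] ≤ [ b ]
exclusive (yes p) (yes q) ¬pq b = contradiction q (¬pq p)
exclusive (yes _) (no _)  ¬pq b = ≤-reflexive (+-identityʳ _)
exclusive (no _)  (yes _) ¬pq b = ≤-refl
exclusive (no _)  (no _)  ¬pq b = z≤n

-- `numEdges` counts ones above the diagonal. These and their mirror images are disjoint because `<`
-- is asymmetric.
handshake : ∀ {n} (G : Graph n) → 2 * numEdges G ≤ ones full full (adj G)
handshake G = begin
  2 * numEdges G                                  ≡⟨ cong (2 *_) (numEdges≡ G) ⟩
  2 * ∑∑ up                                       ≡⟨ cong (∑∑ up +_) (trans (+-identityʳ _) (∑-comm up)) ⟩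
  ∑∑ up + ∑∑ (λ i j → up j i)                     ≡⟨ ∑∑-distrib-+ up (λ i j → up j i) ⟨
  ∑∑ (λ i j → up i j + up j i)                    ≤⟨ ∑∑-mono-≤ entry ⟩
  ones full full (adj G)                          ∎
  where
  open ≤-Reasoning
  up = λ i j → [ i <ᵇ j ∧ adj G i j ]
  entry : ∀ i j → up i j + up j i ≤ [ adj G i j ]
  entry i j rewrite Graph.sym G j i = exclusive (toℕ i <? toℕ j) (toℕ j <? toℕ i) <-asym (adj G i j)

module _ {n} (G : Graph n) {u v : Fin n} (uv : adj G u v ≡ true) where

  u≢v : u ≢ v
  u≢v refl = contradiction (trans (sym uv) (irrefl G u)) λ ()

  adj-deleteEdge : ∀ k l → [ adj G k l ] ≤ [ adj (deleteEdge G u v) k l ] + [ sameEdge u v k l ]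
  adj-deleteEdge k l = entry (adj G k l) (sameEdge u v k l)
    where
    entry : ∀ g e → [ g ] ≤ [ g ∧ not e ] + [ e ]
    entry = from-yes (∀Bool? λ g → ∀Bool? λ e → [ g ] ≤? ([ g ∧ not e ] + [ e ]))

  sameEdge-≤ : ∀ k l → [ sameEdge u v k l ] ≤ [ δ u k ∧ δ v l ] + [ δ v k ∧ δ u l ]
  sameEdge-≤ k l = entry (δ u k ∧ δ v l) (δ v k ∧ δ u l)
    where
    entry : ∀ b c → [ b ∨ c ] ≤ [ b ] + [ c ]
    entry = from-yes (∀Bool? λ b → ∀Bool? λ c → [ b ∨ c ] ≤? ([ b ] + [ c ]))

  -- The deleted edge occupies the entries `(u , v)` and `(v , u)`, which lie in different rows
  -- because `u ≢ v`.
  sameEdge-row : ∀ k → size (sameEdge u v k) ≤ 1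
  sameEdge-row k = begin
    size (sameEdge u v k)                                ≤⟨ sum-mono-≤ (sameEdge-≤ k) ⟩
    sum (λ l → [ δ u k ∧ δ v l ] + [ δ v k ∧ δ u l ])    ≡⟨ ∑-distrib-+ (λ l → [ δ u k ∧ δ v l ]) (λ l → [ δ v k ∧ δ u l ]) ⟩
    size (λ l → δ u k ∧ δ v l) + size (λ l → δ v k ∧ δ u l) ≡⟨ cong₂ _+_ (row u v) (row v u) ⟩
    [ δ u k ] + [ δ v k ]                                ≤⟨ at-most-one ⟩
    1                                                    ∎
    where
    open ≤-Reasoning
    row : ∀ i j → size (λ l → δ i k ∧ δ j l) ≡ [ δ i k ]
    row i j = trans (sum-cong-≗ λ l → [∧]-* (δ i k) (δ j l))
      (trans (sym (*-distribˡ-sum [ δ i k ] (λ l → [ δ j l ]))) (trans (cong ([ δ i k ] *_) (sum-δ j)) (*-identityʳ _)))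
    at-most-one : [ δ u k ] + [ δ v k ] ≤ 1
    at-most-one with k Fin.≟ u | k Fin.≟ v
    ... | yes refl | yes refl = contradiction refl u≢v
    ... | yes _    | no _     = ≤-refl
    ... | no _     | yes _    = ≤-refl
    ... | no _     | no _     = z≤n

  sameEdge-total : ∑∑ (λ k l → [ sameEdge u v k l ]) ≤ 2
  sameEdge-total = begin
    ∑∑ (λ k l → [ sameEdge u v k l ])                                ≤⟨ ∑∑-mono-≤ sameEdge-≤ ⟩
    ∑∑ (λ k l → [ δ u k ∧ δ v l ] + [ δ v k ∧ δ u l ])               ≡⟨ ∑∑-distrib-+ (λ k l → [ δ u k ∧ δ v l ]) (λ k l → [ δ v k ∧ δ u l ]) ⟩
    ∑∑ (λ k l → [ δ u k ∧ δ v l ]) + ∑∑ (λ k l → [ δ v k ∧ δ u l ])  ≡⟨ cong₂ _+_ (∑∑-δδ u v) (∑∑-δδ v u) ⟩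
    2                                                                ∎
    where open ≤-Reasoning

  size-deleteEdge : ∀ k → size (adj G k) ≤ size (adj (deleteEdge G u v) k) + 1
  size-deleteEdge k = ≤-trans (sum-mono-≤ (adj-deleteEdge k))
    (≤-trans (≤-reflexive (∑-distrib-+ (λ l → [ adj (deleteEdge G u v) k l ]) (λ l → [ sameEdge u v k l ])))
             (+-monoʳ-≤ _ (sameEdge-row k)))

  ones-deleteEdge : ones full full (adj G) ≤ ones full full (adj (deleteEdge G u v)) + 2
  ones-deleteEdge = ≤-trans (∑∑-mono-≤ adj-deleteEdge)
    (≤-trans (≤-reflexive (∑∑-distrib-+ (λ k l → [ adj (deleteEdge G u v) k l ]) (λ k l → [ sameEdge u v k l ])))
             (+-monoʳ-≤ _ sameEdge-total))

-- From a matrix to a fractional factor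

half : ℕ → ℚ
half k = ℤ.+ k ℚ./ 2

-- `ℚ./` reduces to lowest terms, so the identity is checked on unnormalised fractions by
-- cross-multiplication.
half-+ : ∀ j k → half j ℚ.+ half k ≡ half (j + k)
half-+ j k = ℚ.toℚᵘ-injective (begin
  ℚ.toℚᵘ (half j ℚ.+ half k)                ≈⟨ ℚ.toℚᵘ-homo-+ (half j) (half k) ⟩
  ℚ.toℚᵘ (half j) ℚᵘ.+ ℚ.toℚᵘ (half k)      ≈⟨ ℚᵘ.+-cong (ℚ.toℚᵘ-fromℚᵘ (mkℚᵘ (ℤ.+ j) 1)) (ℚ.toℚᵘ-fromℚᵘ (mkℚᵘ (ℤ.+ k) 1)) ⟩
  mkℚᵘ (ℤ.+ j) 1 ℚᵘ.+ mkℚᵘ (ℤ.+ k) 1        ≈⟨ *≡* (trans (common (ℤ.+ j) (ℤ.+ k)) (cong (ℤ._* ℤ.+ 4) (sym (ℤ.pos-+ j k)))) ⟩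
  mkℚᵘ (ℤ.+ (j + k)) 1                      ≈⟨ ℚ.toℚᵘ-fromℚᵘ (mkℚᵘ (ℤ.+ (j + k)) 1) ⟨
  ℚ.toℚᵘ (half (j + k))                     ∎)
  where
  open ℚᵘ.≃-Reasoning
  common : ∀ x y → (x ℤ.* ℤ.+ 2 ℤ.+ y ℤ.* ℤ.+ 2) ℤ.* ℤ.+ 2 ≡ (x ℤ.+ y) ℤ.* ℤ.+ 4
  common = ℤ.solve-∀

half-double : ∀ k → half (k + k) ≡ ℤ.+ k ℚ./ 1
half-double k = ℚ.fromℚᵘ-cong {mkℚᵘ (ℤ.+ (k + k)) 1} {mkℚᵘ (ℤ.+ k) 0}
  (*≡* (trans (cong (ℤ._* ℤ.+ 1) (ℤ.pos-+ k k)) (double (ℤ.+ k))))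
  where
  double : ∀ x → (x ℤ.+ x) ℤ.* ℤ.+ 1 ≡ x ℤ.* ℤ.+ 2
  double = ℤ.solve-∀

/1-mono-≤ : ∀ {j k} → j ≤ k → ℤ.+ j ℚ./ 1 ℚ.≤ ℤ.+ k ℚ./ 1
/1-mono-≤ {j} {k} j≤k = ℚ.toℚᵘ-cancel-≤ (begin
  ℚ.toℚᵘ (ℤ.+ j ℚ./ 1)  ≃⟨ ℚ.toℚᵘ-fromℚᵘ (mkℚᵘ (ℤ.+ j) 0) ⟩
  mkℚᵘ (ℤ.+ j) 0        ≤⟨ *≤* (ℤ.*-monoʳ-≤-nonNeg (ℤ.+ 1) (ℤ.+≤+ j≤k)) ⟩
  mkℚᵘ (ℤ.+ k) 0        ≃⟨ ℚ.toℚᵘ-fromℚᵘ (mkℚᵘ (ℤ.+ k) 0) ⟨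
  ℚ.toℚᵘ (ℤ.+ k ℚ./ 1)  ∎)
  where open ℚᵘ.≤-Reasoning

sumℚ-half : ∀ {n} (f : Fin n → ℕ) → sumℚ (map (half ∘ f) (allFin n)) ≡ half (sum f)
sumℚ-half {n} f = trans (cong sumℚ (map-tabulate (λ i → i) (half ∘ f))) (go f)
  where
  go : ∀ {n} (f : Fin n → ℕ) → sumℚ (List.tabulate (half ∘ f)) ≡ half (sum f)
  go {zero}  f = refl
  go {suc n} f = trans (cong (half (f zero) ℚ.+_) (go (f ∘ suc))) (half-+ (f zero) (sum (f ∘ suc)))

-- The weights at `i` add up to half of row sum plus column sum of `M`, hence to exactly `a`.
symmetrise : ∀ {n} (G : Graph n) {a b} → a ≤ b → (M : Matrix n) → (∀ k l → M k l Bool.≤ adj G k l) →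
  (∀ k → size (M k) ≡ a) → (∀ l → size ((M ᵀ) l) ≡ a) → FractionalFactor G a b
symmetrise {n} G {a} {b} a≤b M M≤G rows columns = record
  { h         = λ i j → half (weight i j)
  ; h-sym     = λ i j → cong half (+-comm [ M i j ] [ M j i ])
  ; h-nonedge = λ i j ij → cong half (cong₂ _+_ (vanish i j ij) (vanish j i (trans (Graph.sym G j i) ij)))
  ; h-≥0      = λ i j → proj₁ (bounds (M i j) (M j i))
  ; h-≤1      = λ i j → proj₂ (bounds (M i j) (M j i))
  ; lower     = λ i → ℚ.≤-reflexive (sym (total i))
  ; upper     = λ i → ℚ.≤-trans (ℚ.≤-reflexive (total i)) (/1-mono-≤ a≤b)
  }
  where
  weight : Fin n → Fin n → ℕ
  weight i j = [ M i j ] + [ M j i ]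
  vanish : ∀ i j → adj G i j ≡ false → [ M i j ] ≡ 0
  vanish i j ij with M i j | adj G i j | M≤G i j
  ... | false | _     | _ = refl
  ... | true  | true  | _ = contradiction ij λ ()
  bounds : ∀ b c → 0ℚ ℚ.≤ half ([ b ] + [ c ]) × half ([ b ] + [ c ]) ℚ.≤ 1ℚ
  bounds = from-yes (∀Bool? λ b → ∀Bool? λ c → (0ℚ ℚ.≤? half ([ b ] + [ c ])) ×-dec (half ([ b ] + [ c ]) ℚ.≤? 1ℚ))
  total : ∀ i → sumℚ (map (λ j → half (weight i j)) (allFin n)) ≡ ℤ.+ a ℚ./ 1
  total i = begin
    sumℚ (map (half ∘ weight i) (allFin n))  ≡⟨ sumℚ-half (weight i) ⟩
    half (sum (weight i))                    ≡⟨ cong half (∑-distrib-+ (λ j → [ M i j ]) (λ j → [ M j i ])) ⟩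
    half (size (M i) + size ((M ᵀ) i))       ≡⟨ cong half (cong₂ _+_ (rows i) (columns i)) ⟩
    half (a + a)                             ≡⟨ half-double a ⟩
    ℤ.+ a ℚ./ 1                              ∎
    where open ≡-Reasoning

theorem1p8 : (a b n : ℕ) → 1 ≤ a → 1 ≤ b → (a ⊔ 3) ≤ b → ((a + 2) ⊔ 7) ≤ n →
    (G : Graph n) → minDeg≥ G (a + 1) →
    (n ∸ 1) * (n ∸ 2) + (a + 2) ≤ 2 * numEdges G →
    FractionalDeleted G a b
theorem1p8 a b n 1≤a _ a⊔3≤b a+2⊔7≤n G minDeg manyEdges u v uv =
  let M , M≤H , rows , columns = regular-submatrix a (adj H)
        (dense⇒cut (adj H) (Graph.sym H) a 1≤a (m⊔n≤o⇒m≤o (a + 2) 7 a+2⊔7≤n) (m⊔n≤o⇒n≤o (a + 2) 7 a+2⊔7≤n)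
          (irrefl H) degree dense dense′)
  in  symmetrise H (m⊔n≤o⇒m≤o a 3 a⊔3≤b) M M≤H rows columns
  where
  H = deleteEdge G u v
  S = ones full full (adj H)

  minSize : ∀ k → a + 1 ≤ size (adj G k)
  minSize k = subst (a + 1 ≤_) (deg≡size G k) (minDeg k)

  degree : ∀ k → a ≤ size (adj H k)
  degree k = +-cancelʳ-≤ 1 a _ (≤-trans (minSize k) (size-deleteEdge G uv k))

  -- The edge hypothesis is already doubled, so it bounds the ones of `adj G`. Deleting `uv` costs
  -- two of them, turning `a + 2` into `a`.
  dense : (n ∸ 1) * (n ∸ 2) + a ≤ S
  dense = +-cancelʳ-≤ 2 _ S (begin
    (n ∸ 1) * (n ∸ 2) + a + 2    ≡⟨ +-assoc ((n ∸ 1) * (n ∸ 2)) a 2 ⟩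
    (n ∸ 1) * (n ∸ 2) + (a + 2)  ≤⟨ manyEdges ⟩
    2 * numEdges G               ≤⟨ handshake G ⟩
    ones full full (adj G)       ≤⟨ ones-deleteEdge G uv ⟩
    S + 2                        ∎)
    where open ≤-Reasoning

  -- The degrees are summed in `G`, where deletion costs 2 in total. Summing `degree` over `H` would
  -- give only `n * a ≤ S`, too weak for `n = a + 2`.
  dense′ : n * (a + 1) ≤ S + 2
  dense′ = begin
    n * (a + 1)                  ≡⟨ sum-const n (a + 1) ⟨
    sum {n} (λ _ → a + 1)        ≤⟨ sum-mono-≤ minSize ⟩
    ones full full (adj G)       ≤⟨ ones-deleteEdge G uv ⟩
    S + 2                        ∎
    where open ≤-Reasoning
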